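{- For all $n\ge1$, $$\varphi_n=2(n-1)H_n+2P_n,\qquad \theta_n=(2n-1)P_n.$$
   Context: Let $s=\sqrt3/2$. Consider the standard triangular lattice in the plane whose vertices are the points $(a+b/2,\,bs)$ with $a,b\in\mathbb Z$ and whose edges are the unit segments joining lattice points in the directions $0^\circ,60^\circ,120^\circ$; it divides the plane into unit equilateral triangles called cells. A small tile is a single cell; a large tile is an equilateral triangle of side $2$ whose vertices are lattice points (so it is a union of $4$ cells; it may point up or down). For a region $R$ that is a finite union of cells, a tiling of $R$ is a finite set of small and large tiles, each contained in $R$, with pairwise disjoint interiors and union equal to $R$. For $n\ge1$, the region $H_n$ is the union of the trapezoid with vertices $(0,0),(n,0),(n-\tfrac12,s),(\tfrac12,s)$ and the trapezoid with vertices $(\tfrac12,s),(n-\tfrac12,s),(n,2s),(0,2s)$ ($4n-2$ cells; for $n=1$ two unit triangles meeting at a point), and $P_n$ is $H_n$ with the cell with vertices $(n-1,0),(n,0),(n-\tfrac12,s)$ removed. $H_n$ and $P_n$ also denote the numbers of tilings of these regions; thus $H_n=\frac{(1+\sqrt2)^n+(1-\sqrt2)^n}{2}$ and $P_n=\frac{(1+\sqrt2)^n-(1-\sqrt2)^n}{2\sqrt2}$. Define $\varphi_n$ (resp. $\theta_n$) as the sum, over all tilings of $H_n$ (resp. $P_n$), of the number of small tiles in the tiling. -}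

module Defs where

open import Data.Integer as ℤ using (ℤ; +_; 0ℤ; 1ℤ; _⊖_)
import Data.Integer.Properties as ℤ
open import Data.List
  using (List; []; _∷_; _++_; map; concatMap; filter; length; upTo)
open import Data.List.Relation.Binary.Disjoint.Propositional using (Disjoint)
import Data.List.Relation.Binary.Disjoint.DecPropositional as DecDisjoint
open import Data.List.Relation.Binary.Subset.Propositional using (_⊆_)
import Data.List.Relation.Binary.Subset.DecPropositional as DecSubset
open import Data.List.Relation.Unary.All using (All; all?)
open import Data.List.Relation.Unary.AllPairs using (AllPairs; allPairs?)
open import Data.Nat using (ℕ; _+_)
open import Data.Nat.ListAction using (sum)
open import Data.Product using (_×_; _,_)
open import Data.Sum using (_⊎_)
open import Relation.Binary.Definitions using (DecidableEquality)
open import Relation.Binary.PropositionalEquality using (refl)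
open import Relation.Nullary using (yes; no; ¬?; _×-dec_; _⊎-dec_)
open import Relation.Unary using (Decidable)

-- (a , b) stands for the lattice point (a + b/2 , b·√3/2) of the plane.
Point : Set
Point = ℤ × ℤ

data Cell : Set where
  △ ▽ : ℤ → ℤ → Cell

vertices : Cell → List Point
vertices (△ a b) = (a , b) ∷ (ℤ.suc a , b) ∷ (a , ℤ.suc b) ∷ []
vertices (▽ a b) = (ℤ.suc a , b) ∷ (a , ℤ.suc b) ∷ (ℤ.suc a , ℤ.suc b) ∷ []

_≟_ : DecidableEquality Cell
△ a b ≟ △ c d with a ℤ.≟ c | b ℤ.≟ d
... | yes refl | yes refl = yes refl
... | no  a≢c  | _        = no λ { refl → a≢c refl }
... | yes _    | no  b≢d  = no λ { refl → b≢d refl }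
▽ a b ≟ ▽ c d with a ℤ.≟ c | b ℤ.≟ d
... | yes refl | yes refl = yes refl
... | no  a≢c  | _        = no λ { refl → a≢c refl }
... | yes _    | no  b≢d  = no λ { refl → b≢d refl }
△ _ _ ≟ ▽ _ _ = no λ ()
▽ _ _ ≟ △ _ _ = no λ ()

-- The cells sharing an edge with a given cell.
neighbours : Cell → List Cell
neighbours (△ a b) = ▽ a b ∷ ▽ (ℤ.pred a) b ∷ ▽ a (ℤ.pred b) ∷ []
neighbours (▽ a b) = △ a b ∷ △ (ℤ.suc a) b ∷ △ a (ℤ.suc b) ∷ []

-- A lattice triangle of side 2 is determined by its central cell c, and
-- consists of c and the neighbours of c.  It points up when c points down,
-- and vice versa: large (▽ a b) has corners (a , b), (a+2 , b), (a , b+2), and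
-- large (△ a b) has corners (a+1 , b-1), (a-1 , b+1), (a+1 , b+1).
data Tile : Set where
  small large : Cell → Tile

cells : Tile → List Cell
cells (small c) = c ∷ []
cells (large c) = c ∷ neighbours c

-- A finite union of cells, as a list of its cells without repetitions.
Region : Set
Region = List Cell

-- Tiles and regions are unions of cells, and distinct cells have disjoint
-- interiors: so containment, covering and disjointness of interiors are
-- inclusion and disjointness of sets of cells.
IsTiling : Region → List Tile → Set
IsTiling R T = All (λ t → cells t ⊆ R) T
             × AllPairs (λ t u → Disjoint (cells t) (cells u)) T
             × R ⊆ concatMap cells T

open DecSubset _≟_ using (_⊆?_)
open DecDisjoint _≟_ using (disjoint?)

isTiling? : ∀ R → Decidable (IsTiling R)
isTiling? R T = all? (λ t → cells t ⊆? R) T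
          ×-dec allPairs? (λ t u → disjoint? (cells t) (cells u)) T
          ×-dec (R ⊆? concatMap cells T)

-- A tile contained in R has its (central) cell in R, so each tile contained
-- in R occurs here, exactly once.
tilesIn : Region → List Tile
tilesIn R = filter (λ t → cells t ⊆? R)
                   (concatMap (λ c → small c ∷ large c ∷ []) R)

-- For a list without repetitions, each subset of it occurs exactly once.
subsets : {A : Set} → List A → List (List A)
subsets []       = [] ∷ []
subsets (x ∷ xs) = map (x ∷_) (subsets xs) ++ subsets xs

tilings : Region → List (List Tile)
tilings R = filter (isTiling? R) (subsets (tilesIn R))

#tilings : Region → ℕ
#tilings R = length (tilings R)

data IsSmall : Tile → Set where
  small : ∀ c → IsSmall (small c)

isSmall? : Decidable IsSmall
isSmall? (small c) = yes (small c)
isSmall? (large c) = no λ ()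

#small : List Tile → ℕ
#small T = length (filter isSmall? T)

totalSmall : Region → ℕ
totalSmall R = sum (map #small (tilings R))

-- The trapezoid with corners (0,0), (n,0), (n-½,s), (½,s), where s = √3/2: the
-- slanted sides lie on the lines a = 0 and a + b = n.
Lower : ℕ → Point → Set
Lower n (a , b) = (0ℤ ℤ.≤ b × b ℤ.≤ 1ℤ) × (0ℤ ℤ.≤ a × a ℤ.+ b ℤ.≤ + n)

-- The trapezoid with corners (½,s), (n-½,s), (n,2s), (0,2s): the slanted sides
-- lie on the lines a + b = 1 and a = n - 1.
Upper : ℕ → Point → Set
Upper n (a , b) = (1ℤ ℤ.≤ b × b ℤ.≤ + 2) × (1ℤ ℤ.≤ a ℤ.+ b × a ℤ.≤ n ⊖ 1)

lower? : ∀ n → Decidable (Lower n)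
lower? n (a , b) = ((0ℤ ℤ.≤? b) ×-dec (b ℤ.≤? 1ℤ))
             ×-dec ((0ℤ ℤ.≤? a) ×-dec (a ℤ.+ b ℤ.≤? + n))

upper? : ∀ n → Decidable (Upper n)
upper? n (a , b) = ((1ℤ ℤ.≤? b) ×-dec (b ℤ.≤? + 2))
             ×-dec ((1ℤ ℤ.≤? a ℤ.+ b) ×-dec (a ℤ.≤? n ⊖ 1))

-- The trapezoids are convex and separated by a lattice line, so a cell lies in
-- their union iff all its vertices lie in one of them.
InH : ℕ → Cell → Set
InH n c = All (Lower n) (vertices c) ⊎ All (Upper n) (vertices c)

inH? : ∀ n → Decidable (InH n)
inH? n c = all? (lower? n) (vertices c) ⊎-dec all? (upper? n) (vertices c)

-- All cells with -1 ≤ a ≤ n and 0 ≤ b ≤ 1.  InH n c forces b = 0 and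
-- 0 ≤ a < n, or b = 1 and -1 ≤ a < n - 1.
box : ℕ → List Cell
box n = concatMap (λ i → column (i ⊖ 1)) (upTo (2 + n))
  where
  column : ℤ → List Cell
  column a = △ a 0ℤ ∷ ▽ a 0ℤ ∷ △ a 1ℤ ∷ ▽ a 1ℤ ∷ []

regionH : ℕ → Region
regionH n = filter (inH? n) (box n)

regionP : ℕ → Region
regionP n = filter (λ c → ¬? (c ≟ △ (n ⊖ 1) 0ℤ)) (regionH n)

H P φ θ : ℕ → ℕ
H n = #tilings (regionH n)
P n = #tilings (regionP n)
φ n = totalSmall (regionH n)
θ n = totalSmall (regionP n)

{-# OPTIONS --safe #-}
-- A tiling is determined by its large tiles: any set of pairwise disjoint large
-- tiles contained in R extends uniquely to a tiling, by filling up with small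
-- tiles.  Since #small + 4 #large is the number of cells of R, it suffices to
-- count the independent sets of large tiles, weighted by their sizes.
--
-- For H n, column i carries one large tile pointing up, U i, and one pointing
-- down, D i (0 ≤ i ≤ n - 2); the only overlaps are between U i and D i, U i and
-- U (i+1), D i and D (i+1).  For P n, the last U i is missing.  Deciding on the
-- leftmost column gives Pell-type recurrences for the numbers of independent
-- sets and for their total sizes, and the closed forms follow by induction.
module Submission where

open import Defs

open import Data.Bool using (true; false)
open import Data.Integer as ℤ using (ℤ; +_; 0ℤ; 1ℤ; -1ℤ; _⊖_)
import Data.Integer.Properties as ℤ
open import Data.List
  using (List; []; _∷_; _++_; [_]; map; concatMap; filter; length; upTo; applyUpTo)
import Data.List.Membership.DecPropositional as DecMembership
open import Data.List.Membership.Propositional using (_∈_; _∉_; find)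
open import Data.List.Membership.Propositional.Properties
  using ( ∈-map⁺; ∈-map⁻; ∈-++⁺ˡ; ∈-++⁺ʳ; ∈-++⁻; ∈-filter⁺; ∈-filter⁻
        ; ∈-concatMap⁺; ∈-concatMap⁻; ∈-upTo⁺; ∈-upTo⁻)
open import Data.List.Membership.Propositional.Properties.WithK using (unique∧set⇒bag)
open import Data.List.Properties
  using ( ∷-injectiveʳ; ++-identityʳ; length-++; length-map; map-++
        ; filter-++; filter-none; filter-all; filter-accept; filter-reject
        ; concatMap-map; concatMap-++; map-concatMap; map-upTo; upTo-∷ʳ; length-upTo)
open import Data.List.Relation.Binary.BagAndSetEquality using (∼bag⇒↭)
open import Data.List.Relation.Binary.Disjoint.Propositional using (Disjoint)
import Data.List.Relation.Binary.Disjoint.DecPropositional as DecDisjoint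
open import Data.List.Relation.Binary.Permutation.Propositional using (_↭_)
import Data.List.Relation.Binary.Permutation.Propositional.Properties as Perm
open import Data.List.Relation.Binary.Sublist.Propositional
  using ([]; _∷_; _∷ʳ_; lookup) renaming (_⊆_ to _⊑_)
import Data.List.Relation.Binary.Sublist.Propositional.Properties as Sublist
open import Data.List.Relation.Binary.Subset.Propositional using (_⊆_)
open import Data.List.Relation.Binary.Subset.Propositional.Properties using (⊆-reflexive)
import Data.List.Relation.Binary.Subset.DecPropositional as DecSubset
open import Data.List.Relation.Unary.All as All using (All; []; _∷_; all?)
import Data.List.Relation.Unary.All.Properties as All
open import Data.List.Relation.Unary.AllPairs as AllPairs using (AllPairs; []; _∷_; allPairs?)
import Data.List.Relation.Unary.AllPairs.Properties as AllPairs
open import Data.List.Relation.Unary.Any using (here; there)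
import Data.List.Relation.Unary.Any as Any
open import Data.List.Relation.Unary.Unique.Propositional using (Unique)
import Data.List.Relation.Unary.Unique.Propositional.Properties as Unique
open import Data.Nat using (ℕ; zero; suc; _+_; _*_; _∸_; _≤_; _<_; z≤n; s≤s; s≤s⁻¹)
open import Data.Nat.ListAction using (sum)
open import Data.Nat.ListAction.Properties using (sum-++; sum-↭)
import Data.Nat.Properties as ℕ
open import Data.Nat.Tactic.RingSolver using (solve-∀)
open import Data.Product using (_×_; _,_; proj₁; proj₂; ∃)
open import Data.Sum using (inj₁; inj₂)
open import Function using (_∘_; id; mk⇔)
open import Level using (0ℓ)
open import Relation.Binary.Core using (Rel)
open import Relation.Binary.Definitions
  using (DecidableEquality; Symmetric) renaming (Decidable to Decidable₂)
open import Relation.Binary.PropositionalEquality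
  using (_≡_; _≢_; refl; sym; trans; cong; cong₂; subst; subst₂; module ≡-Reasoning)
open import Relation.Nullary using (¬_; yes; no; does; ¬?; contradiction)
open import Relation.Nullary.Decidable using (map′)
open import Relation.Unary using (Pred; Decidable)

private variable
  A C : Set
  Q : Pred A 0ℓ
  x y : A
  xs ys zs : List A

-- Subsets of a list

∈-subsets⁻ : ∀ xs → ys ∈ subsets {A} xs → ys ⊑ xs
∈-subsets⁻ []       (here refl) = []
∈-subsets⁻ (x ∷ xs) ys∈ with ∈-++⁻ (map (x ∷_) (subsets xs)) ys∈
... | inj₂ ys∈′ = x ∷ʳ ∈-subsets⁻ xs ys∈′
... | inj₁ ys∈′ with _ , zs∈ , refl ← ∈-map⁻ (x ∷_) ys∈′ = refl ∷ ∈-subsets⁻ xs zs∈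

∈-subsets⁺ : ys ⊑ xs → ys ∈ subsets {A} xs
∈-subsets⁺ []         = here refl
∈-subsets⁺ (refl ∷ p) = ∈-++⁺ˡ (∈-map⁺ _ (∈-subsets⁺ p))
∈-subsets⁺ {xs = x ∷ xs} (.x ∷ʳ p) = ∈-++⁺ʳ (map (x ∷_) (subsets xs)) (∈-subsets⁺ p)

subsets-unique : Unique xs → Unique (subsets {A} xs)
subsets-unique []                     = [] ∷ []
subsets-unique {xs = x ∷ xs} u@(_ ∷ xs!) = Unique.++⁺
  (Unique.map⁺ ∷-injectiveʳ (subsets-unique xs!)) (subsets-unique xs!) apart
  where
  apart : Disjoint (map (x ∷_) (subsets xs)) (subsets xs)
  apart (v∈ , v∈′) with _ , _ , refl ← ∈-map⁻ (x ∷_) v∈ =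
    Unique.Unique[x∷xs]⇒x∉xs u (lookup (∈-subsets⁻ xs v∈′) (here refl))

-- Sublists inherit the order of `zs`, so only membership is left to compare. If just one of them
-- keeps the head of `zs`, the inclusion makes that head occur again in the tail, against
-- uniqueness.
⊑-extensional : Unique zs → xs ⊑ zs → ys ⊑ zs → xs ⊆ ys → ys ⊆ xs → xs ≡ ys
⊑-extensional []      []         []         _ _ = refl
⊑-extensional (_ ∷ u) (_ ∷ʳ p)   (_ ∷ʳ q)   s t = ⊑-extensional u p q s t
⊑-extensional u       (refl ∷ p) (_ ∷ʳ q)   s t =
  contradiction (lookup q (s (here refl))) (Unique.Unique[x∷xs]⇒x∉xs u)
⊑-extensional u       (_ ∷ʳ p)   (refl ∷ q) s t =
  contradiction (lookup p (t (here refl))) (Unique.Unique[x∷xs]⇒x∉xs u)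
⊑-extensional u@(_ ∷ u′) (refl ∷ p) (refl ∷ q) s t =
  cong (_ ∷_) (⊑-extensional u′ p q (strip p s) (strip q t))
  where
  strip : ∀ {vs ws} → vs ⊑ _ → (_ ∷ vs) ⊆ (_ ∷ ws) → vs ⊆ ws
  strip p s w∈vs with s (there w∈vs)
  ... | there w∈ws = w∈ws
  ... | here refl  = contradiction (lookup p w∈vs) (Unique.Unique[x∷xs]⇒x∉xs u)

-- Moves a condition on the members of a subset to the ground list; with `R? x` for `Q?`, the branch
-- of `independent-∷` that contains `x` becomes an instance of `independent` again.
subsets-filter : (Q? : Decidable Q) → ∀ xs →
                 filter (all? Q?) (subsets xs) ≡ subsets (filter Q? xs)
subsets-filter Q? []       = refl
subsets-filter {Q = Q} Q? (x ∷ xs) = trans (filter-++ (all? Q?) (map (x ∷_) (subsets xs)) _) helper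
  where
  with-x : ∀ yss → Q x → filter (all? Q?) (map (x ∷_) yss) ≡ map (x ∷_) (filter (all? Q?) yss)
  with-x []         qx = refl
  with-x (ys ∷ yss) qx with Q? x | with-x yss qx
  ... | no ¬qx | _  = contradiction qx ¬qx
  ... | yes _  | ih with does (all? Q? ys)
  ...   | true  = cong ((x ∷ ys) ∷_) ih
  ...   | false = ih

  without-x : ∀ yss → ¬ Q x → filter (all? Q?) (map (x ∷_) yss) ≡ []
  without-x yss ¬qx = filter-none (all? Q?) (All.map⁺ (All.universal (λ _ → ¬qx ∘ All.head) yss))

  helper : filter (all? Q?) (map (x ∷_) (subsets xs)) ++ filter (all? Q?) (subsets xs)
         ≡ subsets (filter Q? (x ∷ xs))
  helper with Q? x
  ... | yes qx = cong₂ _++_ (trans (with-x (subsets xs) qx) (cong (map (x ∷_)) (subsets-filter Q? xs)))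
                            (subsets-filter Q? xs)
  ... | no ¬qx = cong₂ _++_ (without-x (subsets xs) ¬qx) (subsets-filter Q? xs)

-- Independent subsets

-- `R` plays the part of compatibility, that is, of non-adjacency: the independent sets are the
-- lists with pairwise related entries.
module Independent {R : Rel A 0ℓ} (R? : Decidable₂ R) where

  independent : List A → List (List A)
  independent xs = filter (allPairs? R?) (subsets xs)

  -- Branching on whether `x` is chosen: once it is, the other members must come from the entries
  -- compatible with it.
  independent-∷ : ∀ x xs → independent (x ∷ xs)
                ≡ map (x ∷_) (independent (filter (R? x) xs)) ++ independent xs
  independent-∷ x xs = begin
    independent (x ∷ xs)
      ≡⟨ filter-++ (allPairs? R?) (map (x ∷_) (subsets xs)) _ ⟩
    filter (allPairs? R?) (map (x ∷_) (subsets xs)) ++ independent xs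
      ≡⟨ cong (_++ _) (with-x (subsets xs)) ⟩
    map (x ∷_) (filter (allPairs? R?) (filter (all? (R? x)) (subsets xs))) ++ independent xs
      ≡⟨ cong (λ yss → map (x ∷_) (filter (allPairs? R?) yss) ++ _) (subsets-filter (R? x) xs) ⟩
    map (x ∷_) (independent (filter (R? x) xs)) ++ independent xs ∎
    where
    open ≡-Reasoning
    with-x : ∀ yss → filter (allPairs? R?) (map (x ∷_) yss)
           ≡ map (x ∷_) (filter (allPairs? R?) (filter (all? (R? x)) yss))
    with-x []         = refl
    with-x (ys ∷ yss) with does (all? (R? x) ys)
    ... | false = with-x yss
    ... | true with does (allPairs? R? ys)
    ...   | true  = cong ((x ∷ ys) ∷_) (with-x yss)
    ...   | false = with-x yss

  count size : List A → ℕ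
  count xs = length (independent xs)
  size  xs = sum (map length (independent xs))

  count-∷ : ∀ x xs → count (x ∷ xs) ≡ count (filter (R? x) xs) + count xs
  count-∷ x xs = begin
    count (x ∷ xs)
      ≡⟨ cong length (independent-∷ x xs) ⟩
    length (map (x ∷_) (independent (filter (R? x) xs)) ++ independent xs)
      ≡⟨ length-++ (map (x ∷_) (independent (filter (R? x) xs))) ⟩
    length (map (x ∷_) (independent (filter (R? x) xs))) + count xs
      ≡⟨ cong (_+ count xs) (length-map (x ∷_) (independent (filter (R? x) xs))) ⟩
    count (filter (R? x) xs) + count xs ∎
    where open ≡-Reasoning

  size-∷ : ∀ x xs → size (x ∷ xs)
         ≡ count (filter (R? x) xs) + size (filter (R? x) xs) + size xs
  size-∷ x xs = begin
    size (x ∷ xs)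
      ≡⟨ cong (sum ∘ map length) (independent-∷ x xs) ⟩
    sum (map length (map (x ∷_) is ++ independent xs))
      ≡⟨ cong sum (map-++ length (map (x ∷_) is) _) ⟩
    sum (map length (map (x ∷_) is) ++ map length (independent xs))
      ≡⟨ sum-++ (map length (map (x ∷_) is)) _ ⟩
    sum (map length (map (x ∷_) is)) + size xs
      ≡⟨ cong (_+ size xs) (lengths is) ⟩
    length is + sum (map length is) + size xs ∎
    where
    open ≡-Reasoning
    is = independent (filter (R? x) xs)
    lengths : ∀ yss → sum (map length (map (x ∷_) yss)) ≡ length yss + sum (map length yss)
    lengths []         = refl
    lengths (ys ∷ yss) = cong suc (trans (cong (λ m → length ys + m) (lengths yss))
      (x+[y+z]≡y+[x+z] (length ys) (length yss) _))
      where
      x+[y+z]≡y+[x+z] : ∀ a b c → a + (b + c) ≡ b + (a + c)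
      x+[y+z]≡y+[x+z] = solve-∀

allPairs-lookup : {R : Rel A 0ℓ} → Symmetric R → AllPairs R xs →
                  x ∈ xs → y ∈ xs → x ≢ y → R x y
allPairs-lookup sy (r ∷ rs) (here refl) (here refl) x≢y = contradiction refl x≢y
allPairs-lookup sy (r ∷ rs) (here refl) (there y∈)  x≢y = All.lookup r y∈
allPairs-lookup sy (r ∷ rs) (there x∈)  (here refl) x≢y = sy (All.lookup r x∈)
allPairs-lookup sy (r ∷ rs) (there x∈)  (there y∈)  x≢y = allPairs-lookup sy rs x∈ y∈ x≢y

allPairs-tabulate : {R : Rel A 0ℓ} → Unique xs →
                    (∀ {x y} → x ∈ xs → y ∈ xs → x ≢ y → R x y) → AllPairs R xs
allPairs-tabulate []        f = []
allPairs-tabulate (x∉ ∷ xs!) f =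
  All.tabulate (λ y∈ → f (here refl) (there y∈) (All.lookup x∉ y∈))
  ∷ allPairs-tabulate xs! (λ x∈ y∈ → f (there x∈) (there y∈))

-- Tilings

small-injective : ∀ {c d} → Tile.small c ≡ small d → c ≡ d
small-injective refl = refl

large-injective : ∀ {c d} → large c ≡ large d → c ≡ d
large-injective refl = refl

_≟ᵗ_ : DecidableEquality Tile
small c ≟ᵗ small d = map′ (cong small) small-injective (c ≟ d)
large c ≟ᵗ large d = map′ (cong large) large-injective (c ≟ d)
small _ ≟ᵗ large _ = no λ ()
large _ ≟ᵗ small _ = no λ ()

open DecMembership _≟_ using (_∈?_)
open DecMembership _≟ᵗ_ using () renaming (_∈?_ to _∈ᵗ?_)
open DecSubset _≟_ using (_⊆?_)
open DecDisjoint _≟_ using (disjoint?)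

IsLarge : Tile → Set
IsLarge t = ¬ IsSmall t

isLarge? : Decidable IsLarge
isLarge? t = ¬? (isSmall? t)

larges : List Tile → List Tile
larges = filter isLarge?

fits? : ∀ R → Decidable (λ t → cells t ⊆ R)
fits? R t = cells t ⊆? R

Compatible : Rel Tile 0ℓ
Compatible t u = Disjoint (cells t) (cells u)

compatible? : Decidable₂ Compatible
compatible? t u = disjoint? (cells t) (cells u)

open Independent compatible?

tilesAt : Cell → List Tile
tilesAt c = small c ∷ large c ∷ []

larges-tilesIn : ∀ R → larges (tilesIn R) ≡ filter (fits? R) (map large R)
larges-tilesIn R = go (fits? R) R
  where
  -- `R` is both the list and a parameter of the predicate; keeping the predicate arbitrary lets the
  -- induction shrink the list alone.
  go : {Q : Pred Tile 0ℓ} (Q? : Decidable Q) → ∀ cs →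
       larges (filter Q? (concatMap tilesAt cs)) ≡ filter Q? (map large cs)
  go Q? []       = refl
  go Q? (c ∷ cs) with does (Q? (small c))
  go Q? (c ∷ cs) | true with does (Q? (large c))
  ... | true  = cong (large c ∷_) (go Q? cs)
  ... | false = go Q? cs
  go Q? (c ∷ cs) | false with does (Q? (large c))
  ... | true  = cong (large c ∷_) (go Q? cs)
  ... | false = go Q? cs

small∈tilesIn : ∀ {R c} → c ∈ R → small c ∈ tilesIn R
small∈tilesIn {R} {c} c∈R = ∈-filter⁺ (fits? R)
  (∈-concatMap⁺ _ (Any.map (λ { refl → here refl }) c∈R))
  λ { (here refl) → c∈R }

pred[i]≢i : ∀ {i} → ℤ.pred i ≢ i
pred[i]≢i {i} eq = ℤ.i≢suc[i] (trans (sym (ℤ.suc-pred i)) (cong ℤ.suc eq))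

abscissa ordinate : Cell → ℤ
abscissa (△ a _) = a
abscissa (▽ a _) = a
ordinate (△ _ b) = b
ordinate (▽ _ b) = b

-- The centre differs from its neighbours in orientation; any two neighbours differ by a unit shift
-- in some coordinate.
cells-unique : ∀ t → Unique (cells t)
cells-unique (small _)       = [] ∷ []
cells-unique (large (△ a b)) =
    ((λ ()) ∷ (λ ()) ∷ (λ ()) ∷ [])
  ∷ (pred[i]≢i ∘ sym ∘ cong abscissa ∷ pred[i]≢i ∘ sym ∘ cong ordinate ∷ [])
  ∷ (pred[i]≢i ∘ cong abscissa ∷ [])
  ∷ [] ∷ []
cells-unique (large (▽ a b)) =
    ((λ ()) ∷ (λ ()) ∷ (λ ()) ∷ [])
  ∷ (ℤ.i≢suc[i] ∘ cong abscissa ∷ ℤ.i≢suc[i] ∘ cong ordinate ∷ [])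
  ∷ (ℤ.i≢suc[i] ∘ sym ∘ cong abscissa ∷ [])
  ∷ [] ∷ []

tilesIn-unique : ∀ {R} → Unique R → Unique (tilesIn R)
tilesIn-unique {R} R! = Unique.filter⁺ (fits? R) (go R!)
  where
  fresh : ∀ {c cs} → All (c ≢_) cs →
          All (small c ≢_) (concatMap tilesAt cs)
        × All (large c ≢_) (concatMap tilesAt cs)
  fresh []        = [] , []
  fresh (c≢ ∷ cs) with s , l ← fresh cs =
    (c≢ ∘ small-injective) ∷ (λ ()) ∷ s , (λ ()) ∷ (c≢ ∘ large-injective) ∷ l

  go : ∀ {cs} → Unique cs → Unique (concatMap tilesAt cs)
  go []        = []
  go (c∉ ∷ cs!) with s , l ← fresh c∉ = ((λ ()) ∷ s) ∷ l ∷ go cs!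

covered : List Tile → List Cell
covered = concatMap cells

∈-covered⁺ : ∀ {t c T} → t ∈ T → c ∈ cells t → c ∈ covered T
∈-covered⁺ t∈T c∈t = ∈-concatMap⁺ cells (Any.map (λ { refl → c∈t }) t∈T)

∈-covered⁻ : ∀ {c} T → c ∈ covered T → ∃ λ t → t ∈ T × c ∈ cells t
∈-covered⁻ T c∈ with find (∈-concatMap⁻ cells {T} c∈)
... | t , t∈T , c∈t = t , t∈T , c∈t

compatible-sym : Symmetric Compatible
compatible-sym d (v∈ , v∈′) = d (v∈′ , v∈)

-- A large tile of `T` covering `c` would overlap `small c`. With the next lemma, the small tiles of
-- a tiling sit exactly on the cells that its large tiles leave free.
small∈⇒uncovered : ∀ {R T c} → IsTiling R T → small c ∈ T → c ∉ covered (larges T)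
small∈⇒uncovered {T = T} (_ , disjoint , _) c∈T c∈ with ∈-covered⁻ (larges T) c∈
... | t , t∈ , c∈t with t∈T , t-large ← ∈-filter⁻ isLarge? {xs = T} t∈ =
  allPairs-lookup compatible-sym disjoint c∈T t∈T (λ { refl → t-large (small _) }) (here refl , c∈t)

uncovered⇒small∈ : ∀ {R T c} → IsTiling R T → c ∈ R → c ∉ covered (larges T) → small c ∈ T
uncovered⇒small∈ {T = T} (_ , _ , cover) c∈R c∉ with ∈-covered⁻ T (cover c∈R)
... | small _ , t∈T , here refl = t∈T
... | large d , t∈T , c∈t = contradiction (∈-covered⁺ (∈-filter⁺ isLarge? t∈T λ ()) c∈t) c∉

-- Large tiles transfer along the equation, and small tiles because both tilings leave the same
-- cells uncovered by large tiles. Applied in both directions, this shows that a tiling is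
-- determined by its large tiles.
larges-⊆ : ∀ {R T U} → IsTiling R T → IsTiling R U → larges T ≡ larges U → T ⊆ U
larges-⊆ {T = T} {U} Tt Ut eq {large c} t∈T =
  proj₁ (∈-filter⁻ isLarge? {xs = U} (subst (large c ∈_) eq (∈-filter⁺ isLarge? t∈T λ ())))
larges-⊆ {T = T} {U} Tt Ut eq {small c} t∈T =
  uncovered⇒small∈ Ut (All.lookup (proj₁ Tt) t∈T (here refl))
    (subst (λ L → c ∉ covered L) eq (small∈⇒uncovered Tt t∈T))

-- Selects the tiles of the tiling whose large tiles are `L`: those of `L` itself, and a small tile
-- on each remaining cell.
Completes : List Tile → Tile → Set
Completes L (small c) = c ∉ covered L
Completes L (large c) = large c ∈ L

completes? : ∀ L → Decidable (Completes L)
completes? L (small c) = ¬? (c ∈? covered L)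
completes? L (large c) = large c ∈ᵗ? L

m+4*n≡k⇒m+4*[1+n]≡4+k : ∀ {m n k} → m + 4 * n ≡ k → m + 4 * suc n ≡ 4 + k
m+4*n≡k⇒m+4*[1+n]≡4+k {m} {n} refl = identity m n
  where
  identity : ∀ m n → m + 4 * suc n ≡ 4 + (m + 4 * n)
  identity = solve-∀

-- True even for overlapping tiles, since `covered` keeps repetitions. The split on the centre of a
-- large tile lets `neighbours` compute to three cells.
#small+4*#large : ∀ T → #small T + 4 * length (larges T) ≡ length (covered T)
#small+4*#large []                  = refl
#small+4*#large (small c ∷ T)       = cong suc (#small+4*#large T)
#small+4*#large (large (△ _ _) ∷ T) = m+4*n≡k⇒m+4*[1+n]≡4+k {#small T} (#small+4*#large T)
#small+4*#large (large (▽ _ _) ∷ T) = m+4*n≡k⇒m+4*[1+n]≡4+k {#small T} (#small+4*#large T)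

-- Tilings and independent sets of large tiles

module _ {R : Region} (R! : Unique R) where

  private
    L₀ = larges (tilesIn R)
    tiles! = tilesIn-unique R!

  ∈-tilings⁻ : ∀ {T} → T ∈ tilings R → T ⊑ tilesIn R × IsTiling R T
  ∈-tilings⁻ T∈ with T∈′ , Tt ← ∈-filter⁻ (isTiling? R) {xs = subsets (tilesIn R)} T∈ =
    ∈-subsets⁻ (tilesIn R) T∈′ , Tt

  -- Disjointness makes `covered T` free of repetitions, and containment and covering give it the
  -- same elements as `R`; hence it is a permutation of `R`.
  #small-tiling : ∀ {T} → T ∈ tilings R → #small T + 4 * length (larges T) ≡ length R
  #small-tiling {T} T∈ with T⊑ , Tt@(inside , disjoint , cover) ← ∈-tilings⁻ T∈ =
    trans (#small+4*#large T) (Perm.↭-length (∼bag⇒↭ (unique∧set⇒bag covered! R! (mk⇔ to cover))))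
    where
    covered! : Unique (covered T)
    covered! = Unique.concat⁺ (All.map⁺ (All.universal cells-unique T)) (AllPairs.map⁺ disjoint)
    to : covered T ⊆ R
    to c∈ with t , t∈T , c∈t ← ∈-covered⁻ T c∈ = All.lookup inside t∈T c∈t

  -- Obtained by filtering `tilesIn R` rather than by adding small tiles to `L`, so that it is a
  -- sublist and therefore occurs in `subsets (tilesIn R)`.
  complete : List Tile → List Tile
  complete L = filter (completes? L) (tilesIn R)

  module _ {L : List Tile} (L⊑ : L ⊑ L₀) (disjoint : AllPairs Compatible L) where

    -- Both sides are sublists of the repetition-free `L₀`, so it suffices to compare their members.
    larges-complete : larges (complete L) ≡ L
    larges-complete = ⊑-extensional (Unique.filter⁺ isLarge? tiles!)
      (Sublist.filter⁺ isLarge? isLarge? (λ { refl p → p }) (Sublist.filter-⊆ (completes? L) (tilesIn R))) L⊑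
      to from
      where
      to : larges (complete L) ⊆ L
      to {t} t∈ with t∈′ , t-large ← ∈-filter⁻ isLarge? {xs = complete L} t∈
                with _ , c ← ∈-filter⁻ (completes? L) {xs = tilesIn R} t∈′ | t
      ... | small _ = contradiction (small _) t-large
      ... | large _ = c
      from : L ⊆ larges (complete L)
      from {t} t∈ with t∈′ , t-large ← ∈-filter⁻ isLarge? {xs = tilesIn R} (lookup L⊑ t∈) | t
      ... | small _ = contradiction (small _) t-large
      ... | large _ = ∈-filter⁺ isLarge? (∈-filter⁺ (completes? L) t∈′ t∈) t-large

    -- Small tiles avoid `covered L` and large ones come from the pairwise disjoint `L`, so nothing
    -- overlaps; a cell outside `covered L` is filled by its own small tile.
    complete-isTiling : IsTiling R (complete L)
    complete-isTiling =
        All.filter⁺ (completes? L) (All.all-filter (fits? R) (concatMap tilesAt R))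
      , allPairs-tabulate (Unique.filter⁺ (completes? L) tiles!) apart
      , cover
      where
      apart : ∀ {t u} → t ∈ complete L → u ∈ complete L → t ≢ u → Compatible t u
      apart {t} {u} t∈ u∈ t≢u
        with _ , ct ← ∈-filter⁻ (completes? L) {xs = tilesIn R} t∈
           | _ , cu ← ∈-filter⁻ (completes? L) {xs = tilesIn R} u∈ | t | u
      ... | small _ | small _ = λ { (here refl , here refl) → t≢u refl }
      ... | small _ | large _ = λ { (here refl , c∈u) → ct (∈-covered⁺ cu c∈u) }
      ... | large _ | small _ = λ { (c∈t , here refl) → cu (∈-covered⁺ ct c∈t) }
      ... | large _ | large _ = allPairs-lookup compatible-sym disjoint ct cu t≢u
      cover : R ⊆ covered (complete L)
      cover {c} c∈R with c ∈? covered L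
      ... | no c∉ = ∈-covered⁺ (∈-filter⁺ (completes? L) (small∈tilesIn c∈R) c∉) (here refl)
      ... | yes c∈ with t , t∈L , c∈t ← ∈-covered⁻ L c∈ =
        ∈-covered⁺ (proj₁ (∈-filter⁻ isLarge? {xs = complete L} (subst (t ∈_) (sym larges-complete) t∈L))) c∈t

  -- `larges` is injective on tilings by `larges-⊆`, and `complete` supplies preimages. Both lists
  -- are thus free of repetitions and have the same elements.
  tilings↭independent : map larges (tilings R) ↭ independent L₀
  tilings↭independent = ∼bag⇒↭ (unique∧set⇒bag larges! independent! (mk⇔ to from))
    where
    larges! : Unique (map larges (tilings R))
    larges! = AllPairs.map⁺ (allPairs-tabulate
      (Unique.filter⁺ (isTiling? R) (subsets-unique tiles!)) distinct)
      where
      distinct : ∀ {T U} → T ∈ tilings R → U ∈ tilings R → T ≢ U → larges T ≢ larges U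
      distinct T∈ U∈ T≢U eq
        with T⊑ , Tt ← ∈-tilings⁻ T∈ | U⊑ , Ut ← ∈-tilings⁻ U∈ =
        T≢U (⊑-extensional tiles! T⊑ U⊑ (larges-⊆ Tt Ut eq) (larges-⊆ Ut Tt (sym eq)))

    independent! : Unique (independent L₀)
    independent! = Unique.filter⁺ (allPairs? compatible?)
      (subsets-unique (Unique.filter⁺ isLarge? tiles!))

    to : map larges (tilings R) ⊆ independent L₀
    to L∈ with T , T∈ , refl ← ∈-map⁻ larges L∈
          with T⊑ , (_ , disjoint , _) ← ∈-tilings⁻ T∈ =
      ∈-filter⁺ (allPairs? compatible?)
        (∈-subsets⁺ (Sublist.filter⁺ isLarge? isLarge? (λ { refl p → p }) T⊑))
        (AllPairs.filter⁺ isLarge? disjoint)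

    from : independent L₀ ⊆ map larges (tilings R)
    from {L} L∈ with L∈′ , disjoint ← ∈-filter⁻ (allPairs? compatible?) {xs = subsets L₀} L∈ =
      subst (_∈ map larges (tilings R)) (larges-complete L⊑ disjoint)
        (∈-map⁺ larges (∈-filter⁺ (isTiling? R)
          (∈-subsets⁺ (Sublist.filter-⊆ (completes? L) (tilesIn R)))
          (complete-isTiling L⊑ disjoint)))
      where L⊑ = ∈-subsets⁻ L₀ L∈′

  #tilings≡count : #tilings R ≡ count L₀
  #tilings≡count = trans (sym (length-map larges (tilings R))) (Perm.↭-length tilings↭independent)

  -- Sums `#small-tiling` over all tilings, then replaces tilings by independent sets through the
  -- permutation.
  totalSmall+4*size : totalSmall R + 4 * size L₀ ≡ count L₀ * length R
  totalSmall+4*size = begin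
    totalSmall R + 4 * size L₀
      ≡⟨ cong (λ m → totalSmall R + 4 * m) (sum-↭ (Perm.map⁺ length tilings↭independent)) ⟨
    totalSmall R + 4 * sum (map length (map larges (tilings R)))
      ≡⟨ go (tilings R) id ⟩
    #tilings R * length R
      ≡⟨ cong (_* length R) #tilings≡count ⟩
    count L₀ * length R ∎
    where
    open ≡-Reasoning
    rearrange : ∀ a b c d → (a + b) + 4 * (c + d) ≡ (a + 4 * c) + (b + 4 * d)
    rearrange = solve-∀
    -- The inclusion is carried along because `#small-tiling` holds only for members of `tilings R`.
    go : ∀ Ts → Ts ⊆ tilings R →
         sum (map #small Ts) + 4 * sum (map length (map larges Ts)) ≡ length Ts * length R
    go []       _ = refl
    go (T ∷ Ts) s = trans
      (rearrange (#small T) (sum (map #small Ts)) (length (larges T)) _)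
      (cong₂ _+_ (#small-tiling (s (here refl))) (go Ts (s ∘ there)))

-- The regions, column by column

filter-concatMap : (Q? : Decidable Q) {f g : C → List A} {cs : List C} →
                   All (λ c → filter Q? (f c) ≡ g c) cs →
                   filter Q? (concatMap f cs) ≡ concatMap g cs
filter-concatMap Q? []                 = refl
filter-concatMap Q? {f} {cs = c ∷ _} (eq ∷ eqs) =
  trans (filter-++ Q? (f c) _) (cong₂ _++_ eq (filter-concatMap Q? eqs))

-- Repeats the helper local to `box` under an accessible name; the two agree by computation.
column : ℤ → List Cell
column a = △ a 0ℤ ∷ ▽ a 0ℤ ∷ △ a 1ℤ ∷ ▽ a 1ℤ ∷ []

columns : ℕ → List Cell
columns k = concatMap (λ i → column (+ i)) (upTo k)

columns-suc : ∀ k → columns (suc k) ≡ columns k ++ column (+ k)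
columns-suc k = trans (cong (concatMap (λ i → column (+ i))) (sym (upTo-∷ʳ k)))
                      (concatMap-++ (λ i → column (+ i)) (upTo k) [ k ])

-- The part common to both regions for `n = suc k`. The extra cell is the leftmost one of the upper
-- trapezoid, the only cell of abscissa -1.
trunk : ℕ → List Cell
trunk k = ▽ -1ℤ 1ℤ ∷ columns k

abscissa-column : ∀ {a c} → c ∈ column a → abscissa c ≡ a
abscissa-column (here refl)                         = refl
abscissa-column (there (here refl))                 = refl
abscissa-column (there (there (here refl)))         = refl
abscissa-column (there (there (there (here refl)))) = refl

∈-columns : ∀ {k i c} → i < k → c ∈ column (+ i) → c ∈ columns k
∈-columns i<k c∈ = ∈-concatMap⁺ _ (Any.map (λ { refl → c∈ }) (∈-upTo⁺ i<k))

box-unique : ∀ n → Unique (box n)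
box-unique n = Unique.concat⁺ (All.map⁺ (All.universal (λ i → column-unique (i ⊖ 1)) (upTo (2 + n))))
  (AllPairs.map⁺ (AllPairs.map apart (Unique.upTo⁺ (2 + n))))
  where
  column-unique : ∀ a → Unique (column a)
  column-unique a = ((λ ()) ∷ (λ ()) ∷ (λ ()) ∷ []) ∷ ((λ ()) ∷ (λ ()) ∷ [])
                  ∷ ((λ ()) ∷ []) ∷ [] ∷ []
  ⊖1-injective : ∀ i j → i ⊖ 1 ≡ j ⊖ 1 → i ≡ j
  ⊖1-injective zero    zero    _    = refl
  ⊖1-injective (suc i) (suc j) refl = refl
  apart : ∀ {i j} → i ≢ j → Disjoint (column (i ⊖ 1)) (column (j ⊖ 1))
  apart i≢j (c∈ , c∈′) = i≢j (⊖1-injective _ _ (trans (sym (abscissa-column c∈)) (abscissa-column c∈′)))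

regionH-unique : ∀ n → Unique (regionH n)
regionH-unique n = Unique.filter⁺ (inH? n) (box-unique n)

regionP-unique : ∀ n → Unique (regionP n)
regionP-unique n = Unique.filter⁺ _ (regionH-unique n)

lower⁺ : ∀ {n a b} → b ≤ 1 → b + a ≤ n → Lower n (+ a , + b)
lower⁺ {n} {a} {b} b≤1 b+a≤n =
  (ℤ.+≤+ z≤n , ℤ.+≤+ b≤1) , (ℤ.+≤+ z≤n , ℤ.+≤+ (subst (_≤ n) (ℕ.+-comm b a) b+a≤n))

upper⁺ : ∀ {k a b} → 1 ≤ b → b ≤ 2 → a ≤ k → Upper (suc k) (+ a , + b)
upper⁺ {a = a} {b} 1≤b b≤2 a≤k =
  (ℤ.+≤+ 1≤b , ℤ.+≤+ b≤2) , (ℤ.+≤+ (ℕ.≤-trans 1≤b (ℕ.m≤n+m b a)) , ℤ.+≤+ a≤k)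

-- Here `i = k` is allowed: the bottom row ends with one cell beyond the full columns, the one that
-- is removed for `regionP`.
△0∈H : ∀ {k i} → i ≤ k → InH (suc k) (△ (+ i) 0ℤ)
△0∈H i≤k = inj₁ (lower⁺ z≤n (ℕ.m≤n⇒m≤1+n i≤k) ∷ lower⁺ z≤n (s≤s i≤k) ∷ lower⁺ (s≤s z≤n) (s≤s i≤k) ∷ [])

column∈H : ∀ {k i} → i < k → All (InH (suc k)) (column (+ i))
column∈H i<k =
    △0∈H i≤k
  ∷ inj₁ (lower⁺ z≤n (s≤s i≤k) ∷ lower⁺ 1≤1 (s≤s i≤k) ∷ lower⁺ 1≤1 (s≤s i<k) ∷ [])
  ∷ inj₂ (upper⁺ 1≤1 1≤2 i≤k ∷ upper⁺ 1≤1 1≤2 i<k ∷ upper⁺ 1≤2 2≤2 i≤k ∷ [])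
  ∷ inj₂ (upper⁺ 1≤1 1≤2 i<k ∷ upper⁺ 1≤2 2≤2 i≤k ∷ upper⁺ 1≤2 2≤2 i<k ∷ [])
  ∷ []
  where
  i≤k = ℕ.<⇒≤ i<k
  1≤1 = ℕ.≤-refl {1}
  2≤2 = ℕ.≤-refl {2}
  1≤2 : 1 ≤ 2
  1≤2 = s≤s z≤n

△0∉H : ∀ k → ¬ InH (suc k) (△ (+ suc k) 0ℤ)
△0∉H k (inj₁ (_ ∷ (_ , _ , ℤ.+≤+ 2+k+0≤1+k) ∷ _)) =
  ℕ.<-irrefl refl (subst (_≤ suc k) (ℕ.+-identityʳ (2 + k)) 2+k+0≤1+k)
△0∉H k (inj₂ (((ℤ.+≤+ () , _) , _) ∷ _))

column∉H : ∀ {k i} → k ≤ i →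
           ¬ InH (suc k) (▽ (+ i) 0ℤ) × ¬ InH (suc k) (△ (+ i) 1ℤ) × ¬ InH (suc k) (▽ (+ i) 1ℤ)
column∉H {k} {i} k≤i =
    (λ { (inj₁ (_ ∷ _ ∷ (_ , _ , ℤ.+≤+ 1+i+1≤1+k) ∷ []))
           → ℕ.<⇒≱ (s≤s k≤i) (s≤s⁻¹ (subst (_≤ suc k) (ℕ.+-comm (suc i) 1) 1+i+1≤1+k))
       ; (inj₂ (((ℤ.+≤+ () , _) , _) ∷ _)) })
  , (λ { (inj₁ (_ ∷ _ ∷ ((_ , ℤ.+≤+ (s≤s ())) , _) ∷ []))
       ; (inj₂ (_ ∷ (_ , _ , ℤ.+≤+ 1+i≤k) ∷ _)) → ℕ.<⇒≱ (s≤s k≤i) 1+i≤k })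
  , (λ { (inj₁ (_ ∷ ((_ , ℤ.+≤+ (s≤s ())) , _) ∷ _))
       ; (inj₂ ((_ , _ , ℤ.+≤+ 1+i≤k) ∷ _)) → ℕ.<⇒≱ (s≤s k≤i) 1+i≤k })

regionH≡ : ∀ k → regionH (suc k) ≡ trunk k ++ [ △ (+ k) 0ℤ ]
-- Column -1 is settled by computation, leaving the corner cell. Of columns 0 to `suc k`, those
-- before `k` stay whole, column `k` keeps its first cell, and the last one disappears.
regionH≡ k = cong (▽ -1ℤ 1ℤ ∷_) (begin
  filter inH (concatMap (λ i → column (i ⊖ 1)) (applyUpTo suc (2 + k)))
    ≡⟨ cong (filter inH ∘ concatMap (λ i → column (i ⊖ 1))) (sym (map-upTo suc (2 + k))) ⟩
  filter inH (concatMap (λ i → column (i ⊖ 1)) (map suc (upTo (2 + k))))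
    ≡⟨ cong (filter inH) (concatMap-map (λ i → column (i ⊖ 1)) suc (upTo (2 + k))) ⟩
  filter inH (columns (2 + k))
    ≡⟨ cong (filter inH) (columns-suc (suc k)) ⟩
  filter inH (columns (suc k) ++ column (+ suc k))
    ≡⟨ filter-++ inH (columns (suc k)) _ ⟩
  filter inH (columns (suc k)) ++ filter inH (column (+ suc k))
    ≡⟨ cong₂ _++_ (cong (filter inH) (columns-suc k)) (filter-none inH outside) ⟩
  filter inH (columns k ++ column (+ k)) ++ []
    ≡⟨ ++-identityʳ _ ⟩
  filter inH (columns k ++ column (+ k))
    ≡⟨ filter-++ inH (columns k) _ ⟩
  filter inH (columns k) ++ filter inH (column (+ k))
    ≡⟨ cong₂ _++_
         (filter-concatMap inH (All.tabulate (λ i∈ → filter-all inH (column∈H (∈-upTo⁻ i∈)))))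
         (trans (filter-accept inH {△ (+ k) 0ℤ} {▽ (+ k) 0ℤ ∷ △ (+ k) 1ℤ ∷ ▽ (+ k) 1ℤ ∷ []}
                  (△0∈H ℕ.≤-refl))
                (cong (△ (+ k) 0ℤ ∷_) (filter-none inH border))) ⟩
  columns k ++ [ △ (+ k) 0ℤ ] ∎)
  where
  open ≡-Reasoning
  inH = inH? (suc k)
  outside : All (λ c → ¬ InH (suc k) c) (column (+ suc k))
  outside with p , q , r ← column∉H {k} (ℕ.n≤1+n k) = △0∉H k ∷ p ∷ q ∷ r ∷ []
  border : All (λ c → ¬ InH (suc k) c) (▽ (+ k) 0ℤ ∷ △ (+ k) 1ℤ ∷ ▽ (+ k) 1ℤ ∷ [])
  border with p , q , r ← column∉H {k} ℕ.≤-refl = p ∷ q ∷ r ∷ []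

regionP≡ : ∀ k → regionP (suc k) ≡ trunk k
regionP≡ k = begin
  filter kept? (regionH (suc k))          ≡⟨ cong (filter kept?) (regionH≡ k) ⟩
  filter kept? (trunk k ++ [ △ (+ k) 0ℤ ]) ≡⟨ filter-++ kept? (trunk k) _ ⟩
  filter kept? (trunk k) ++ filter kept? [ △ (+ k) 0ℤ ]
    ≡⟨ cong₂ _++_ (filter-all kept? (All.tabulate kept)) (filter-reject kept? (λ ¬refl → ¬refl refl)) ⟩
  trunk k ++ []                            ≡⟨ ++-identityʳ _ ⟩
  trunk k ∎
  where
  open ≡-Reasoning
  kept? : Decidable (_≢ △ (+ k) 0ℤ)
  kept? c = ¬? (c ≟ △ (+ k) 0ℤ)
  kept : ∀ {c} → c ∈ trunk k → c ≢ △ (+ k) 0ℤ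
  -- The abscissas occurring in `columns k` are below `k`.
  kept (there c∈) refl with i , i∈ , c∈′ ← find (∈-concatMap⁻ (λ i → column (+ i)) {upTo k} c∈) =
    ℕ.<-irrefl (sym (ℤ.+-injective (abscissa-column c∈′))) (∈-upTo⁻ i∈)

length-trunk : ∀ k → length (trunk k) ≡ 1 + k * 4
length-trunk k = cong suc (trans (go (upTo k)) (cong (_* 4) (length-upTo k)))
  where
  go : ∀ is → length (concatMap (λ i → column (+ i)) is) ≡ length is * 4
  go []       = refl
  go (i ∷ is) = cong (λ m → 4 + m) (go is)

length-regionP : ∀ k → length (regionP (suc k)) ≡ 1 + k * 4
length-regionP k = trans (cong length (regionP≡ k)) (length-trunk k)

length-regionH : ∀ k → length (regionH (suc k)) ≡ 2 + k * 4
length-regionH k = begin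
  length (regionH (suc k))          ≡⟨ cong length (regionH≡ k) ⟩
  length (trunk k ++ [ △ (+ k) 0ℤ ]) ≡⟨ length-++ (trunk k) ⟩
  length (trunk k) + 1               ≡⟨ ℕ.+-comm (length (trunk k)) 1 ⟩
  suc (length (trunk k))             ≡⟨ cong suc (length-trunk k) ⟩
  2 + k * 4                         ∎
  where open ≡-Reasoning

-- Large tiles pointing up (U) and down (D)

U D : ℕ → Tile
U i = large (▽ (+ i) 0ℤ)
D i = large (△ (+ i) 1ℤ)

-- This cell and the ones in the next two lemmas are those that the large tiles centred at `△ _ 0ℤ`,
-- `▽ _ 1ℤ` and `▽ -1ℤ 1ℤ` would need outside the region.
below∉H : ∀ {n a} → ▽ a -1ℤ ∉ regionH n
below∉H {n} c∈ with proj₂ (∈-filter⁻ (inH? n) {xs = box n} c∈)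
... | inj₁ (((() , _) , _) ∷ _)
... | inj₂ (((() , _) , _) ∷ _)

above∉H : ∀ {n a} → △ a (+ 2) ∉ regionH n
above∉H {n} c∈ with proj₂ (∈-filter⁻ (inH? n) {xs = box n} c∈)
... | inj₁ (((_ , ℤ.+≤+ (s≤s ())) , _) ∷ _)
... | inj₂ (_ ∷ _ ∷ ((_ , ℤ.+≤+ (s≤s (s≤s ()))) , _) ∷ [])

left∉H : ∀ {n} → △ -1ℤ 1ℤ ∉ regionH n
left∉H {n} c∈ with proj₂ (∈-filter⁻ (inH? n) {xs = box n} c∈)
... | inj₁ ((_ , () , _) ∷ _)
... | inj₂ ((_ , ℤ.+≤+ () , _) ∷ _)

fits-accept : ∀ {R} t ts → cells t ⊆ R → filter (fits? R) (t ∷ ts) ≡ t ∷ filter (fits? R) ts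
fits-accept {R} t ts = filter-accept (fits? R) {t} {ts}

fits-reject : ∀ {R} t ts → ¬ cells t ⊆ R → filter (fits? R) (t ∷ ts) ≡ filter (fits? R) ts
fits-reject {R} t ts = filter-reject (fits? R) {t} {ts}

-- The first and last candidates stick out below and above. `U i` is left undecided, as it is the
-- one that the removed cell can affect.
larges-column : ∀ {R n i} → R ⊆ regionH n → cells (D i) ⊆ R →
                filter (fits? R) (map large (column (+ i))) ≡ filter (fits? R) [ U i ] ++ [ D i ]
larges-column {R} {n} {i} R⊆H D⊆R = begin
  filter (fits? R) (large (△ (+ i) 0ℤ) ∷ U i ∷ D i ∷ large (▽ (+ i) 1ℤ) ∷ [])
    ≡⟨ fits-reject (large (△ (+ i) 0ℤ)) _ (λ s → below∉H {n} {+ i} (R⊆H (s (there (there (there (here refl))))))) ⟩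
  filter (fits? R) ([ U i ] ++ D i ∷ large (▽ (+ i) 1ℤ) ∷ [])
    ≡⟨ filter-++ (fits? R) [ U i ] _ ⟩
  filter (fits? R) [ U i ] ++ filter (fits? R) (D i ∷ large (▽ (+ i) 1ℤ) ∷ [])
    ≡⟨ cong (filter (fits? R) [ U i ] ++_) (trans (fits-accept (D i) _ D⊆R)
         (cong (D i ∷_) (fits-reject (large (▽ (+ i) 1ℤ)) []
           (λ s → above∉H {n} {+ i} (R⊆H (s (there (there (there (here refl)))))))))) ⟩
  filter (fits? R) [ U i ] ++ [ D i ] ∎
  where open ≡-Reasoning

D⊆trunk : ∀ {k i} → i < k → cells (D i) ⊆ trunk k
D⊆trunk i<k (here refl) = there (∈-columns i<k (there (there (here refl))))
D⊆trunk i<k (there (here refl)) = there (∈-columns i<k (there (there (there (here refl)))))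
-- The left neighbour of the first centre is the corner cell, which is in no full column.
D⊆trunk {i = zero}  i<k (there (there (here refl))) = here refl
D⊆trunk {i = suc i} i<k (there (there (here refl))) =
  there (∈-columns (ℕ.<-trans (ℕ.n<1+n i) i<k) (there (there (there (here refl)))))
D⊆trunk i<k (there (there (there (here refl)))) = there (∈-columns i<k (there (here refl)))

-- The right neighbour belongs to the next column, and for `suc i = k` it lies outside the trunk.
-- Its presence is a hypothesis because there the two regions differ.
U⊆ : ∀ {R k i} → trunk k ⊆ R → i < k → △ (+ suc i) 0ℤ ∈ R → cells (U i) ⊆ R
U⊆ s i<k c∈R (here refl)                         = s (there (∈-columns i<k (there (here refl))))
U⊆ s i<k c∈R (there (here refl))                 = s (there (∈-columns i<k (here refl)))
U⊆ s i<k c∈R (there (there (here refl)))         = c∈R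
U⊆ s i<k c∈R (there (there (there (here refl)))) = s (there (∈-columns i<k (there (there (here refl)))))

pair : ℕ → List Tile
pair i = U i ∷ D i ∷ []

-- `j` counts the columns in which both tiles fit: all `k` of them for `regionH`, one fewer for
-- `regionP`.
larges-columns : ∀ {R n k} → R ⊆ regionH n → trunk k ⊆ R → ∀ j → j ≤ k →
                 (∀ {i} → i < j → △ (+ suc i) 0ℤ ∈ R) →
                 filter (fits? R) (map large (columns j)) ≡ concatMap pair (upTo j)
larges-columns {R} {n} R⊆H trunk⊆R j j≤k △∈R =
  trans (cong (filter (fits? R)) (map-concatMap large (λ i → column (+ i)) (upTo j)))
        (filter-concatMap (fits? R) (All.tabulate both))
  where
  both : ∀ {i} → i ∈ upTo j → filter (fits? R) (map large (column (+ i))) ≡ pair i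
  both {i} i∈ with i<j ← ∈-upTo⁻ i∈ with i<k ← ℕ.<-≤-trans i<j j≤k =
    trans (larges-column {n = n} R⊆H (trunk⊆R ∘ D⊆trunk i<k))
          (cong (_++ [ D i ]) (fits-accept (U i) [] (U⊆ trunk⊆R i<k (△∈R i<j))))

larges-skip-corner : ∀ {R n} → R ⊆ regionH n → ∀ cs →
                     filter (fits? R) (map large (▽ -1ℤ 1ℤ ∷ cs)) ≡ filter (fits? R) (map large cs)
larges-skip-corner {R} {n} R⊆H cs =
  fits-reject (large (▽ -1ℤ 1ℤ)) (map large cs) (λ s → left∉H {n} (R⊆H (s (there (here refl)))))

larges-regionH : ∀ k → larges (tilesIn (regionH (suc k))) ≡ concatMap pair (upTo k)
larges-regionH k = begin
  larges (tilesIn R)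
    ≡⟨ larges-tilesIn R ⟩
  fitting (map large R)
    ≡⟨ cong (fitting ∘ map large) (regionH≡ k) ⟩
  fitting (map large (trunk k ++ [ △ (+ k) 0ℤ ]))
    ≡⟨ larges-skip-corner {R} {suc k} id (columns k ++ [ △ (+ k) 0ℤ ]) ⟩
  fitting (map large (columns k ++ [ △ (+ k) 0ℤ ]))
    ≡⟨ cong fitting (map-++ large (columns k) _) ⟩
  fitting (map large (columns k) ++ [ large (△ (+ k) 0ℤ) ])
    ≡⟨ filter-++ (fits? R) (map large (columns k)) _ ⟩
  fitting (map large (columns k)) ++ fitting [ large (△ (+ k) 0ℤ) ]
    ≡⟨ cong₂ _++_ (larges-columns {R} {suc k} id trunk⊆R k ℕ.≤-refl △∈R)
         (fits-reject (large (△ (+ k) 0ℤ)) [] (λ s → below∉H {suc k} {+ k} (s (there (there (there (here refl))))))) ⟩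
  concatMap pair (upTo k) ++ []
    ≡⟨ ++-identityʳ _ ⟩
  concatMap pair (upTo k) ∎
  where
  open ≡-Reasoning
  R = regionH (suc k)
  fitting = filter (fits? R)
  trunk⊆R : trunk k ⊆ R
  trunk⊆R = ⊆-reflexive (sym (regionH≡ k)) ∘ ∈-++⁺ˡ
  △∈R : ∀ {i} → i < k → △ (+ suc i) 0ℤ ∈ R
  △∈R i<k with ℕ.m≤n⇒m<n∨m≡n i<k
  ... | inj₁ 1+i<k = trunk⊆R (there (∈-columns 1+i<k (here refl)))
  -- The last `U` needs the bottom cell that follows the trunk.
  ... | inj₂ refl  = ⊆-reflexive (sym (regionH≡ k)) (∈-++⁺ʳ (trunk k) (here refl))

-- The last column loses `U k`, whose right neighbour is the removed cell. The index starts at 2 so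
-- that there is a last column.
larges-regionP : ∀ k → larges (tilesIn (regionP (2 + k))) ≡ concatMap pair (upTo k) ++ [ D k ]
larges-regionP k = begin
  larges (tilesIn R)
    ≡⟨ larges-tilesIn R ⟩
  fitting (map large R)
    ≡⟨ cong (fitting ∘ map large) (regionP≡ (suc k)) ⟩
  fitting (map large (trunk (suc k)))
    ≡⟨ larges-skip-corner {R} {2 + k} R⊆H (columns (suc k)) ⟩
  fitting (map large (columns (suc k)))
    ≡⟨ cong (fitting ∘ map large) (columns-suc k) ⟩
  fitting (map large (columns k ++ column (+ k)))
    ≡⟨ cong fitting (map-++ large (columns k) _) ⟩
  fitting (map large (columns k) ++ map large (column (+ k)))
    ≡⟨ filter-++ (fits? R) (map large (columns k)) _ ⟩
  fitting (map large (columns k)) ++ fitting (map large (column (+ k)))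
    ≡⟨ cong₂ _++_
         (larges-columns {R} {2 + k} R⊆H trunk⊆R k (ℕ.n≤1+n k)
           (λ i<k → trunk⊆R (there (∈-columns (s≤s i<k) (here refl)))))
         (trans (larges-column {R} {2 + k} R⊆H (trunk⊆R ∘ D⊆trunk (ℕ.n<1+n k)))
           (cong (_++ [ D k ]) (fits-reject (U k) [] (λ s → removed (s (there (there (here refl)))))))) ⟩
  concatMap pair (upTo k) ++ [ D k ] ∎
  where
  open ≡-Reasoning
  R = regionP (2 + k)
  fitting = filter (fits? R)
  kept? : Decidable (_≢ △ (+ suc k) 0ℤ)
  kept? c = ¬? (c ≟ △ (+ suc k) 0ℤ)
  R⊆H : R ⊆ regionH (2 + k)
  R⊆H c∈ = proj₁ (∈-filter⁻ kept? {xs = regionH (2 + k)} c∈)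
  removed : △ (+ suc k) 0ℤ ∉ R
  removed c∈ = proj₂ (∈-filter⁻ kept? {xs = regionH (2 + k)} c∈) refl
  trunk⊆R : trunk (suc k) ⊆ R
  trunk⊆R = ⊆-reflexive (sym (regionP≡ (suc k)))

-- Overlaps between large tiles

disjoint⁺ : All (λ x → All (x ≢_) ys) xs → Disjoint xs ys
disjoint⁺ apart (v∈xs , v∈ys) = All.lookup (All.lookup apart v∈xs) v∈ys refl

left-of : ∀ {c d} → abscissa c ℤ.< abscissa d → c ≢ d
left-of a<b = ℤ.<⇒≢ a<b ∘ cong abscissa

-- Among cells of equal orientation, only each centre and one neighbour of the other tile lie in the
-- same row, and these have abscissas `i` and `j`.
UD-compatible : ∀ {i j} → i < j → Compatible (U i) (D j)
UD-compatible i<j = disjoint⁺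
  ( ((λ ()) ∷ (λ ()) ∷ (λ ()) ∷ left-of (ℤ.+<+ i<j) ∷ [])
  ∷ ((λ ()) ∷ (λ ()) ∷ (λ ()) ∷ (λ ()) ∷ [])
  ∷ ((λ ()) ∷ (λ ()) ∷ (λ ()) ∷ (λ ()) ∷ [])
  ∷ (left-of (ℤ.+<+ i<j) ∷ (λ ()) ∷ (λ ()) ∷ (λ ()) ∷ [])
  ∷ [])

DU-compatible : ∀ {i j} → i < j → Compatible (D i) (U j)
DU-compatible i<j = disjoint⁺
  ( ((λ ()) ∷ (λ ()) ∷ (λ ()) ∷ left-of (ℤ.+<+ i<j) ∷ [])
  ∷ ((λ ()) ∷ (λ ()) ∷ (λ ()) ∷ (λ ()) ∷ [])
  ∷ ((λ ()) ∷ (λ ()) ∷ (λ ()) ∷ (λ ()) ∷ [])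
  ∷ (left-of (ℤ.+<+ i<j) ∷ (λ ()) ∷ (λ ()) ∷ (λ ()) ∷ [])
  ∷ [])

UU-compatible : ∀ {i j} → suc i < j → Compatible (U i) (U j)
UU-compatible {i} {j} 1+i<j = disjoint⁺
  ( (left-of i<j ∷ (λ ()) ∷ (λ ()) ∷ (λ ()) ∷ [])
  ∷ ((λ ()) ∷ left-of i<j ∷ left-of (ℤ.+<+ (ℕ.<-trans (ℕ.n<1+n i) (ℕ.m<n⇒m<1+n 1+i<j))) ∷ (λ ()) ∷ [])
  ∷ ((λ ()) ∷ left-of (ℤ.+<+ 1+i<j) ∷ left-of (ℤ.+<+ (ℕ.m<n⇒m<1+n 1+i<j)) ∷ (λ ()) ∷ [])
  ∷ ((λ ()) ∷ (λ ()) ∷ (λ ()) ∷ left-of i<j ∷ [])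
  ∷ [])
  where i<j = ℤ.+<+ (ℕ.<-trans (ℕ.n<1+n i) 1+i<j)

DD-compatible : ∀ {i j} → suc i < j → Compatible (D i) (D j)
-- The bound forces the second index to be a successor, on which `ℤ.pred` computes; `ℤ.pred (+ i)`
-- stays stuck and is bounded by `i-1<i`.
DD-compatible {i} {suc j} 1+i<1+j@(s≤s i<j) = disjoint⁺
  ( (left-of i<1+j ∷ (λ ()) ∷ (λ ()) ∷ (λ ()) ∷ [])
  ∷ ((λ ()) ∷ left-of i<1+j ∷ left-of (ℤ.+<+ i<j) ∷ (λ ()) ∷ [])
  ∷ ((λ ()) ∷ left-of (ℤ.<-trans i-1<i i<1+j) ∷ left-of (ℤ.<-trans i-1<i (ℤ.+<+ i<j)) ∷ (λ ()) ∷ [])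
  ∷ ((λ ()) ∷ (λ ()) ∷ (λ ()) ∷ left-of i<1+j ∷ [])
  ∷ [])
  where
  i<1+j = ℤ.+<+ (ℕ.m<n⇒m<1+n i<j)
  i-1<i : ℤ.pred (+ i) ℤ.< + i
  i-1<i = ℤ.i≤pred[j]⇒i<j ℤ.≤-refl

UD-overlap : ∀ {i} → ¬ Compatible (U i) (D i)
UD-overlap d = d (here refl , there (there (there (here refl))))

UU-overlap : ∀ {i} → ¬ Compatible (U i) (U (suc i))
UU-overlap d = d (there (there (here refl)) , there (here refl))

DD-overlap : ∀ {i} → ¬ Compatible (D i) (D (suc i))
DD-overlap d = d (there (here refl) , there (there (here refl)))

-- Recurrences along a strip of columns

module Strip (end : ℕ → List Tile)
             (U-end : ∀ {i j} → suc i < j → All (Compatible (U i)) (end j))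
             (D-end : ∀ {i j} → suc i < j → All (Compatible (D i)) (end j)) where

  -- `k` full columns starting at `i`, closed by `end`. The end is empty for `regionH` and a lone
  -- `D` for `regionP`, so one set of recurrences serves both.
  strip : ℕ → ℕ → List Tile
  strip zero    i = end i
  strip (suc k) i = U i ∷ D i ∷ strip k (suc i)

  strip-upTo : ∀ k → concatMap pair (upTo k) ++ end k ≡ strip k 0
  strip-upTo k = go id k 0 (λ _ → refl)
    where
    -- `upTo` unfolds through `applyUpTo` with an ever more shifted function, so `f` is kept general
    -- and tied to the starting column.
    go : ∀ f k i → (∀ j → f j ≡ i + j) → concatMap pair (applyUpTo f k) ++ end (i + k) ≡ strip k i
    go f zero    i eq = cong end (ℕ.+-identityʳ i)
    go f (suc k) i eq = cong₂ (λ j ts → U j ∷ D j ∷ ts) (trans (eq 0) (ℕ.+-identityʳ i))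
      (trans (cong (λ j → concatMap pair (applyUpTo (f ∘ suc) k) ++ end j) (ℕ.+-suc i k))
             (go (f ∘ suc) k (suc i) (λ j → trans (eq (suc j)) (ℕ.+-suc i j))))

  U-strip : ∀ k {i j} → suc i < j → All (Compatible (U i)) (strip k j)
  U-strip zero    1+i<j = U-end 1+i<j
  U-strip (suc k) 1+i<j =
    UU-compatible 1+i<j ∷ UD-compatible (ℕ.<-trans (ℕ.n<1+n _) 1+i<j) ∷ U-strip k (ℕ.m<n⇒m<1+n 1+i<j)

  D-strip : ∀ k {i j} → suc i < j → All (Compatible (D i)) (strip k j)
  D-strip zero    1+i<j = D-end 1+i<j
  D-strip (suc k) 1+i<j =
    DU-compatible (ℕ.<-trans (ℕ.n<1+n _) 1+i<j) ∷ DD-compatible 1+i<j ∷ D-strip k (ℕ.m<n⇒m<1+n 1+i<j)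

  -- What can still be chosen to the right of column `i` once `U i`, respectively `D i`, has been
  -- taken.
  afterU afterD : ℕ → ℕ → List Tile
  afterU k i = filter (compatible? (U i)) (strip k (suc i))
  afterD k i = filter (compatible? (D i)) (strip k (suc i))

  afterU-D∷ : ∀ k i → filter (compatible? (U i)) (D i ∷ strip k (suc i)) ≡ afterU k i
  afterU-D∷ k i = filter-reject (compatible? (U i)) {D i} {strip k (suc i)} (UD-overlap {i})

  -- To the right of its own column, `U i` overlaps only `U (suc i)`.
  afterU-suc : ∀ k i → afterU (suc k) i ≡ D (suc i) ∷ strip k (2 + i)
  afterU-suc k i = begin
    filter c? (U (suc i) ∷ D (suc i) ∷ strip k (2 + i))
      ≡⟨ filter-reject c? {U (suc i)} {D (suc i) ∷ strip k (2 + i)} (UU-overlap {i}) ⟩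
    filter c? (D (suc i) ∷ strip k (2 + i))
      ≡⟨ filter-all c? (UD-compatible (ℕ.n<1+n i) ∷ U-strip k (ℕ.n<1+n (suc i))) ⟩
    D (suc i) ∷ strip k (2 + i) ∎
    where
    open ≡-Reasoning
    c? = compatible? (U i)

  afterD-suc : ∀ k i → afterD (suc k) i ≡ U (suc i) ∷ strip k (2 + i)
  afterD-suc k i = begin
    filter c? (U (suc i) ∷ D (suc i) ∷ strip k (2 + i))
      ≡⟨ filter-accept c? {U (suc i)} {D (suc i) ∷ strip k (2 + i)} (DU-compatible (ℕ.n<1+n i)) ⟩
    U (suc i) ∷ filter c? (D (suc i) ∷ strip k (2 + i))
      ≡⟨ cong (U (suc i) ∷_) (filter-reject c? {D (suc i)} {strip k (2 + i)} (DD-overlap {i})) ⟩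
    U (suc i) ∷ filter c? (strip k (2 + i))
      ≡⟨ cong (U (suc i) ∷_) (filter-all c? (D-strip k (ℕ.n<1+n (suc i)))) ⟩
    U (suc i) ∷ strip k (2 + i) ∎
    where
    open ≡-Reasoning
    c? = compatible? (D i)

  -- The recurrences involve the two kinds of remainders only through their sum.
  countₛ sizeₛ countₐ sizeₐ : ℕ → ℕ → ℕ
  countₛ k i = count (strip k i)
  sizeₛ  k i = size (strip k i)
  countₐ k i = count (afterU k i) + count (afterD k i)
  sizeₐ  k i = size (afterU k i) + size (afterD k i)

  -- Column `i` contributes `U i`, `D i` or nothing, as the two tiles overlap each other.
  countₛ-suc : ∀ k i → countₛ (suc k) i ≡ countₐ k i + countₛ k (suc i)
  countₛ-suc k i = begin
    count (U i ∷ D i ∷ strip k (suc i))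
      ≡⟨ count-∷ (U i) (D i ∷ strip k (suc i)) ⟩
    count (filter (compatible? (U i)) (D i ∷ strip k (suc i))) + count (D i ∷ strip k (suc i))
      ≡⟨ cong₂ _+_ (cong count (afterU-D∷ k i)) (count-∷ (D i) (strip k (suc i))) ⟩
    count (afterU k i) + (count (afterD k i) + countₛ k (suc i))
      ≡⟨ ℕ.+-assoc (count (afterU k i)) _ _ ⟨
    countₐ k i + countₛ k (suc i) ∎
    where open ≡-Reasoning

  -- After a `U` the next column offers `D` or nothing, and after a `D` it offers `U` or nothing.
  -- The roles are exchanged, which leaves the sum of the two remainders unchanged; each empty
  -- choice frees the rest of the strip.
  countₐ-suc : ∀ k i → countₐ (suc k) i ≡ countₐ k (suc i) + 2 * countₛ k (2 + i)
  countₐ-suc k i = begin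
    count (afterU (suc k) i) + count (afterD (suc k) i)
      ≡⟨ cong₂ _+_ (trans (cong count (afterU-suc k i)) (count-∷ (D (suc i)) (strip k (2 + i))))
                   (trans (cong count (afterD-suc k i)) (count-∷ (U (suc i)) (strip k (2 + i)))) ⟩
    (count (afterD k (suc i)) + countₛ k (2 + i)) + (count (afterU k (suc i)) + countₛ k (2 + i))
      ≡⟨ rearrange (count (afterD k (suc i))) (count (afterU k (suc i))) (countₛ k (2 + i)) ⟩
    countₐ k (suc i) + 2 * countₛ k (2 + i) ∎
    where
    open ≡-Reasoning
    rearrange : ∀ d u s → (d + s) + (u + s) ≡ (u + d) + 2 * s
    rearrange = solve-∀

  -- The added `countₐ` accounts for the chosen tile of column `i`, once per set containing one.
  sizeₛ-suc : ∀ k i → sizeₛ (suc k) i ≡ sizeₐ k i + countₐ k i + sizeₛ k (suc i)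
  sizeₛ-suc k i = begin
    size (U i ∷ D i ∷ strip k (suc i))
      ≡⟨ size-∷ (U i) (D i ∷ strip k (suc i)) ⟩
    count (filter (compatible? (U i)) (D i ∷ strip k (suc i)))
      + size (filter (compatible? (U i)) (D i ∷ strip k (suc i))) + size (D i ∷ strip k (suc i))
      ≡⟨ cong₂ (λ ts m → count ts + size ts + m) (afterU-D∷ k i) (size-∷ (D i) (strip k (suc i))) ⟩
    count (afterU k i) + size (afterU k i)
      + (count (afterD k i) + size (afterD k i) + sizeₛ k (suc i))
      ≡⟨ rearrange (count (afterU k i)) (size (afterU k i)) (count (afterD k i)) (size (afterD k i)) _ ⟩
    sizeₐ k i + countₐ k i + sizeₛ k (suc i) ∎
    where
    open ≡-Reasoning
    rearrange : ∀ u u′ d d′ s → u + u′ + (d + d′ + s) ≡ (u′ + d′) + (u + d) + s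
    rearrange = solve-∀

  sizeₐ-suc : ∀ k i → sizeₐ (suc k) i ≡ sizeₐ k (suc i) + countₐ k (suc i) + 2 * sizeₛ k (2 + i)
  sizeₐ-suc k i = begin
    size (afterU (suc k) i) + size (afterD (suc k) i)
      ≡⟨ cong₂ _+_ (trans (cong size (afterU-suc k i)) (size-∷ (D (suc i)) (strip k (2 + i))))
                   (trans (cong size (afterD-suc k i)) (size-∷ (U (suc i)) (strip k (2 + i)))) ⟩
    (count (afterD k (suc i)) + size (afterD k (suc i)) + sizeₛ k (2 + i))
      + (count (afterU k (suc i)) + size (afterU k (suc i)) + sizeₛ k (2 + i))
      ≡⟨ rearrange (count (afterD k (suc i))) (size (afterD k (suc i)))
                   (count (afterU k (suc i))) (size (afterU k (suc i))) _ ⟩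
    sizeₐ k (suc i) + countₐ k (suc i) + 2 * sizeₛ k (2 + i) ∎
    where
    open ≡-Reasoning
    rearrange : ∀ d d′ u u′ s → (d + d′ + s) + (u + u′ + s) ≡ (u′ + d′) + (u + d) + 2 * s
    rearrange = solve-∀

-- pell k = P (1 + k) and half k = H (1 + k).
pell half : ℕ → ℕ
pell zero    = 1
pell (suc k) = pell k + half k
half zero    = 1
half (suc k) = half k + 2 * pell k

-- Closed forms for the two strips

module StripH = Strip (λ _ → []) (λ _ → []) (λ _ → [])
module StripP = Strip (λ i → [ D i ])
  (λ 1+i<j → UD-compatible (ℕ.<-trans (ℕ.n<1+n _) 1+i<j) ∷ []) (λ 1+i<j → DD-compatible 1+i<j ∷ [])

-- The recurrences couple all four quantities and shift the starting column, hence a joint induction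
-- for every `i`. Doubling `sizeₛ` and keeping `pell k` on the left avoid division and subtraction.
valuesH : let open StripH in ∀ k i →
    countₛ k i ≡ half k × countₐ k i ≡ 2 * pell k
  × 2 * sizeₛ k i + pell k ≡ suc k * half k × sizeₐ k i ≡ k * pell k
valuesH zero    i = refl , refl , refl , refl
valuesH (suc k) i
  with s₁ , a₁ , S₁ , A₁ ← valuesH k i
     | s₂ , a₂ , S₂ , A₂ ← valuesH k (suc i)
     | s₃ , a₃ , S₃ , A₃ ← valuesH k (2 + i) =
    trans (countₛ-suc k i) (trans (cong₂ _+_ a₁ s₂) (ℕ.+-comm (2 * pell k) (half k)))
  , trans (countₐ-suc k i) (trans (cong₂ (λ a s → a + 2 * s) a₂ s₃) (sym (ℕ.*-distribˡ-+ 2 (pell k) (half k))))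
  , (begin
      2 * sizeₛ (suc k) i + pell (suc k)
        ≡⟨ cong (λ m → 2 * m + pell (suc k)) (sizeₛ-suc k i) ⟩
      2 * (sizeₐ k i + countₐ k i + sizeₛ k (suc i)) + (pell k + half k)
        ≡⟨ cong₂ (λ A a → 2 * (A + a + sizeₛ k (suc i)) + (pell k + half k)) A₁ a₁ ⟩
      2 * (k * pell k + 2 * pell k + sizeₛ k (suc i)) + (pell k + half k)
        ≡⟨ identity₁ k (pell k) (half k) (sizeₛ k (suc i)) ⟩
      (2 * sizeₛ k (suc i) + pell k) + (2 * (k * pell k) + 4 * pell k + half k)
        ≡⟨ cong (_+ (2 * (k * pell k) + 4 * pell k + half k)) S₂ ⟩
      suc k * half k + (2 * (k * pell k) + 4 * pell k + half k)
        ≡⟨ identity₂ k (pell k) (half k) ⟩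
      (2 + k) * half (suc k) ∎)
  , (begin
      sizeₐ (suc k) i
        ≡⟨ sizeₐ-suc k i ⟩
      sizeₐ k (suc i) + countₐ k (suc i) + 2 * sizeₛ k (2 + i)
        ≡⟨ cong₂ (λ A a → A + a + 2 * sizeₛ k (2 + i)) A₂ a₂ ⟩
      k * pell k + 2 * pell k + 2 * sizeₛ k (2 + i)
        ≡⟨ identity₃ k (pell k) (sizeₛ k (2 + i)) ⟩
      (2 * sizeₛ k (2 + i) + pell k) + suc k * pell k
        ≡⟨ cong (_+ suc k * pell k) S₃ ⟩
      suc k * half k + suc k * pell k
        ≡⟨ identity₄ k (pell k) (half k) ⟩
      suc k * pell (suc k) ∎)
  where
  open StripH
  open ≡-Reasoning
  identity₁ : ∀ k p q s → 2 * (k * p + 2 * p + s) + (p + q) ≡ (2 * s + p) + (2 * (k * p) + 4 * p + q)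
  identity₁ = solve-∀
  identity₂ : ∀ k p q → suc k * q + (2 * (k * p) + 4 * p + q) ≡ (2 + k) * (q + 2 * p)
  identity₂ = solve-∀
  identity₃ : ∀ k p s → k * p + 2 * p + 2 * s ≡ (2 * s + p) + suc k * p
  identity₃ = solve-∀
  identity₄ : ∀ k p q → suc k * q + suc k * p ≡ suc k * (p + q)
  identity₄ = solve-∀

-- The lone `D` stands for one more, incomplete column, so the values are those at `suc k`.
valuesP : let open StripP in ∀ k i →
    countₛ k i ≡ pell (suc k) × countₐ k i ≡ half (suc k)
  × 2 * sizeₛ k i ≡ suc k * pell (suc k)
  × 2 * sizeₐ k i + half (suc k) ≡ suc k * half (suc k) + pell (suc k)
valuesP zero    i = refl , cong₂ _+_ (cong count U-only) (cong count D-only) , refl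
                  -- 3 is `half 1`; after `U` one tile remains, after `D` none.
                  , cong (λ m → 2 * m + 3) (cong₂ _+_ (cong size U-only) (cong size D-only))
  where
  open StripP
  U-only : afterU 0 i ≡ [ D (suc i) ]
  U-only = filter-all (compatible? (U i)) (UD-compatible (ℕ.n<1+n i) ∷ [])
  D-only : afterD 0 i ≡ []
  D-only = filter-none (compatible? (D i)) {[ D (suc i) ]} (DD-overlap {i} ∷ [])
valuesP (suc k) i
  with s₁ , a₁ , S₁ , A₁ ← valuesP k i
     | s₂ , a₂ , S₂ , A₂ ← valuesP k (suc i)
     | s₃ , a₃ , S₃ , A₃ ← valuesP k (2 + i) =
    trans (countₛ-suc k i) (trans (cong₂ _+_ a₁ s₂) (ℕ.+-comm q p))
  , trans (countₐ-suc k i) (cong₂ (λ a s → a + 2 * s) a₂ s₃)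
  , (begin
      2 * sizeₛ (suc k) i
        ≡⟨ cong (2 *_) (sizeₛ-suc k i) ⟩
      2 * (sizeₐ k i + countₐ k i + sizeₛ k (suc i))
        ≡⟨ cong (λ a → 2 * (sizeₐ k i + a + sizeₛ k (suc i))) a₁ ⟩
      2 * (sizeₐ k i + q + sizeₛ k (suc i))
        ≡⟨ identity₁ q (sizeₐ k i) (sizeₛ k (suc i)) ⟩
      (2 * sizeₐ k i + q) + q + 2 * sizeₛ k (suc i)
        ≡⟨ cong₂ (λ A S → A + q + S) A₁ S₂ ⟩
      (suc k * q + p) + q + suc k * p
        ≡⟨ identity₂ k p q ⟩
      (2 + k) * (p + q) ∎)
  , (begin
      2 * sizeₐ (suc k) i + (q + 2 * p)
        ≡⟨ cong (λ m → 2 * m + (q + 2 * p)) (sizeₐ-suc k i) ⟩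
      2 * (sizeₐ k (suc i) + countₐ k (suc i) + 2 * sizeₛ k (2 + i)) + (q + 2 * p)
        ≡⟨ cong (λ a → 2 * (sizeₐ k (suc i) + a + 2 * sizeₛ k (2 + i)) + (q + 2 * p)) a₂ ⟩
      2 * (sizeₐ k (suc i) + q + 2 * sizeₛ k (2 + i)) + (q + 2 * p)
        ≡⟨ identity₃ p q (sizeₐ k (suc i)) (sizeₛ k (2 + i)) ⟩
      (2 * sizeₐ k (suc i) + q) + 2 * (2 * sizeₛ k (2 + i)) + (2 * q + 2 * p)
        ≡⟨ cong₂ (λ A S → A + 2 * S + (2 * q + 2 * p)) A₂ S₃ ⟩
      (suc k * q + p) + 2 * (suc k * p) + (2 * q + 2 * p)
        ≡⟨ identity₄ k p q ⟩
      (2 + k) * (q + 2 * p) + (p + q) ∎)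
  where
  open StripP
  open ≡-Reasoning
  p = pell (suc k)
  q = half (suc k)
  identity₁ : ∀ q a s → 2 * (a + q + s) ≡ (2 * a + q) + q + 2 * s
  identity₁ = solve-∀
  identity₂ : ∀ k p q → (suc k * q + p) + q + suc k * p ≡ (2 + k) * (p + q)
  identity₂ = solve-∀
  identity₃ : ∀ p q a s → 2 * (a + q + 2 * s) + (q + 2 * p) ≡ (2 * a + q) + 2 * (2 * s) + (2 * q + 2 * p)
  identity₃ = solve-∀
  identity₄ : ∀ k p q → (suc k * q + p) + 2 * (suc k * p) + (2 * q + 2 * p) ≡ (2 + k) * (q + 2 * p) + (p + q)
  identity₄ = solve-∀

-- From strips back to the regions

larges-H : ∀ k → larges (tilesIn (regionH (suc k))) ≡ StripH.strip k 0
larges-H k = trans (larges-regionH k) (trans (sym (++-identityʳ _)) (StripH.strip-upTo k))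

larges-P : ∀ k → larges (tilesIn (regionP (2 + k))) ≡ StripP.strip k 0
larges-P k = trans (larges-regionP k) (StripP.strip-upTo k)

H≡half : ∀ k → H (suc k) ≡ half k
H≡half k = trans (#tilings≡count (regionH-unique (suc k)))
                 (trans (cong count (larges-H k)) (proj₁ (valuesH k 0)))

P≡pell : ∀ k → P (suc k) ≡ pell k
-- A single cell, evaluated directly because `larges-P` starts at 2.
P≡pell zero    = refl
P≡pell (suc k) = trans (#tilings≡count (regionP-unique (2 + k)))
                       (trans (cong count (larges-P k)) (proj₁ (valuesP k 0)))

-- The total is cells times tilings minus 4 times the size `s`. As `2 * s` is `suc k * half k` minus
-- `pell k`, this is `(4 * k + 2) * half k` minus `2 * suc k * half k`, plus `2 * pell k`.
-- Cancelling `4 * s` replaces the subtraction.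
φ-formula : ∀ k → φ (suc k) ≡ 2 * k * half k + 2 * pell k
φ-formula k = ℕ.+-cancelʳ-≡ (4 * s) _ _ (begin
  φ (suc k) + 4 * s
    ≡⟨ cong (λ L → φ (suc k) + 4 * size L) (larges-H k) ⟨
  φ (suc k) + 4 * size (larges (tilesIn R))
    ≡⟨ totalSmall+4*size (regionH-unique (suc k)) ⟩
  count (larges (tilesIn R)) * length R
    ≡⟨ cong₂ _*_ (trans (cong count (larges-H k)) (proj₁ (valuesH k 0))) (length-regionH k) ⟩
  half k * (2 + k * 4)
    ≡⟨ identity₁ k (half k) ⟩
  2 * k * half k + 2 * (suc k * half k)
    ≡⟨ cong (λ m → 2 * k * half k + 2 * m) (proj₁ (proj₂ (proj₂ (valuesH k 0)))) ⟨
  2 * k * half k + 2 * (2 * s + pell k)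
    ≡⟨ identity₂ (2 * k * half k) (pell k) s ⟩
  2 * k * half k + 2 * pell k + 4 * s ∎)
  where
  open ≡-Reasoning
  R = regionH (suc k)
  s = StripH.sizeₛ k 0
  identity₁ : ∀ k q → q * (2 + k * 4) ≡ 2 * k * q + 2 * (suc k * q)
  identity₁ = solve-∀
  identity₂ : ∀ a p s → a + 2 * (2 * s + p) ≡ a + 2 * p + 4 * s
  identity₂ = solve-∀

θ-formula : ∀ k → θ (suc k) ≡ (2 * suc k ∸ 1) * pell k
θ-formula zero    = refl
θ-formula (suc k) = ℕ.+-cancelʳ-≡ (4 * s) _ _ (begin
  θ (2 + k) + 4 * s
    ≡⟨ cong (λ L → θ (2 + k) + 4 * size L) (larges-P k) ⟨
  θ (2 + k) + 4 * size (larges (tilesIn R))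
    ≡⟨ totalSmall+4*size (regionP-unique (2 + k)) ⟩
  count (larges (tilesIn R)) * length R
    ≡⟨ cong₂ _*_ (trans (cong count (larges-P k)) (proj₁ (valuesP k 0))) (length-regionP (suc k)) ⟩
  p * (1 + suc k * 4)
    ≡⟨ identity₁ k p ⟩
  (2 * (2 + k) ∸ 1) * p + 2 * (suc k * p)
    ≡⟨ cong (λ m → (2 * (2 + k) ∸ 1) * p + 2 * m) (proj₁ (proj₂ (proj₂ (valuesP k 0)))) ⟨
  (2 * (2 + k) ∸ 1) * p + 2 * (2 * s)
    ≡⟨ cong (λ m → (2 * (2 + k) ∸ 1) * p + m) (sym (ℕ.*-assoc 2 2 s)) ⟩
  (2 * (2 + k) ∸ 1) * p + 4 * s ∎)
  where
  open ≡-Reasoning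
  R = regionP (2 + k)
  s = StripP.sizeₛ k 0
  p = pell (suc k)
  -- The first factor on the right is what `2 * (2 + k) ∸ 1` computes to, which keeps truncated
  -- subtraction out of the ring identity.
  identity₁ : ∀ k p → p * (1 + suc k * 4) ≡ (suc k + suc (suc k + 0)) * p + 2 * (suc k * p)
  identity₁ = solve-∀

theorem6 : ∀ (n : ℕ) → 1 ≤ n →
    (φ n ≡ 2 * (n ∸ 1) * H n + 2 * P n) × (θ n ≡ (2 * n ∸ 1) * P n)
theorem6 (suc k) (s≤s z≤n) =
    subst₂ (λ h p → φ (suc k) ≡ 2 * k * h + 2 * p) (sym (H≡half k)) (sym (P≡pell k)) (φ-formula k)
  , subst (λ p → θ (suc k) ≡ (2 * suc k ∸ 1) * p) (sym (P≡pell k)) (θ-formula k)
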